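{- Let $n,k,t$ be integers with $n\ge 3$, $0<2t\le k\le 2^{n-1}$ and $\frac{1}{24}\le 2^{ -n}t\le \frac{1}{24}+\frac{7}{64}$. Then every $S\subset\{0,1\}^n$ with $|S|=k$ and $\mathrm{Type}(S)=t$ satisfies $\theta(n,S)\ge 2^n f(2^{ -n}k)$; equivalently $\theta(n,k,t)\ge 2^n f(2^{ -n}k)$.
   Context: $Q_n$ is the hypercube graph on $\{0,1\}^n$ (vertices adjacent iff they differ in exactly one coordinate). For $S\subset\{0,1\}^n$, $\theta(n,S)$ is the number of edges of $Q_n$ with exactly one endpoint in $S$. A half plane of $Q_n$ is a set $\{x\in\{0,1\}^n: x_i=a\}$ for some $1\le i\le n$, $a\in\{0,1\}$ (there are $2n$ of them). $\mathrm{Type}(S)=\min_H |S\cap H|$ over all half planes $H$. $\theta(n,k,t)=\min\{\theta(n,S): S\subset\{0,1\}^n, |S|=k, \mathrm{Type}(S)=t\}$. $f(x)=\frac34-\frac{64}{7}\left(x-\frac12\right)^2$ for real $x$. -}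

module Defs where

open import Data.Bool using (Bool; true; false; _xor_; _∧_; not)
open import Data.Product using (_×_; _,_)
open import Data.Bool.Properties using () renaming (_≟_ to _≟ᵇ_)
open import Data.Nat using (ℕ; zero; suc; _+_; _^_; _⊓_)
open import Data.Nat.Properties using (m^n≢0)
open import Data.Fin using (Fin)
open import Data.Vec using (Vec; []; _∷_; lookup; _[_]≔_)
open import Data.List using (List; []; _∷_; map; _++_; filterᵇ; length; allFin; concatMap; foldr)
open import Data.Integer using (+_)
open import Data.Rational using (ℚ; _/_; _-_; _*_)
open import Relation.Nullary.Decidable using (does)

Vertex : ℕ → Set
Vertex n = Vec Bool n

allVertices : (n : ℕ) → List (Vertex n)
allVertices zero = [] ∷ []
allVertices (suc n) = map (false ∷_) (allVertices n) ++ map (true ∷_) (allVertices n)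

VSubset : ℕ → Set
VSubset n = Vertex n → Bool

card : {n : ℕ} → VSubset n → ℕ
card {n} S = length (filterᵇ S (allVertices n))

-- θ(n,S): number of edges of Q_n with exactly one endpoint in S.
-- Every edge is {x, x[i≔1]} for a unique pair (x,i) with x_i = 0.
isCut : {n : ℕ} → VSubset n → Vertex n × Fin n → Bool
isCut S (x , i) = not (lookup x i) ∧ (S x xor S (x [ i ]≔ true))

θ : (n : ℕ) → VSubset n → ℕ
θ n S = length (filterᵇ (isCut S)
  (concatMap (λ x → map (x ,_) (allFin n)) (allVertices n)))

halfPlaneCount : {n : ℕ} → VSubset n → Fin n → Bool → ℕ
halfPlaneCount {n} S i a =
  length (filterᵇ (λ x → S x ∧ does (lookup x i ≟ᵇ a)) (allVertices n))

-- Type(S) = min over all 2n half planes H of |S ∩ H|.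
-- (Minimum of the list of the 2n counts; the seed 2^n is an upper bound of
-- every count, so it does not affect the minimum when n ≥ 1.)
Type : {n : ℕ} → VSubset n → ℕ
Type {n} S = foldr _⊓_ (2 ^ n)
  (concatMap (λ i → halfPlaneCount S i false ∷ halfPlaneCount S i true ∷ []) (allFin n))

_/2^_ : ℕ → ℕ → ℚ
k /2^ n = _/_ (+ k) (2 ^ n) {{m^n≢0 2 n}}

f : ℚ → ℚ
f x = (+ 3 / 4) - (+ 64 / 7) * ((x - + 1 / 2) * (x - + 1 / 2))

{-# OPTIONS --safe #-}

-- Let T be the Takagi function, T(x) = min(x, 1 - x) + T(2x mod 1) / 2. It satisfies
-- T((a + b)/2) ≤ (T(a) + T(b) + |a - b|)/2, so induction on n gives the edge-isoperimetric
-- inequality θ(n, S) ≥ 2ⁿ T(|S| / 2ⁿ). Cut the cube along a half plane attaining Type(S) = t and put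
-- a = 2t/2ⁿ, b = 2(k - t)/2ⁿ. Applying the inequality to both halves, and counting at least k - 2t
-- boundary edges across the cut, gives θ(n, S) ≥ 2ⁿ (T(a) + T(b) + b - a)/2. The right side is at least
-- 2ⁿ f((a + b)/2) because T ≥ 1/2 on [1/6, 5/6], T(x) ≥ 3x on [0, 1/6] and T(x) ≥ x on [0, 2/3].
module Submission where

open import Defs
open import Data.Bool using (Bool; true; false; _xor_; _∧_)
open import Data.Bool.Properties using (xor-comm) renaming (_≟_ to _≟ᵇ_)
open import Data.Empty using (⊥-elim)
open import Data.List using (List; []; _∷_; map; _++_; filterᵇ; length; allFin; concatMap; tabulate)
open import Data.List.Membership.Propositional using (_∈_; find)
open import Data.List.Membership.Propositional.Properties using (foldr-selective; ∈-concatMap⁻)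
open import Data.List.Properties using (concatMap-++; concatMap-map)
open import Data.List.Relation.Unary.Any using (here; there)
open import Data.Product using (∃; ∃₂; _×_; _,_)
open import Data.Sum using (_⊎_; inj₁; inj₂)
open import Function using (_∘_)
open import Relation.Binary.PropositionalEquality using (_≡_; refl; sym; trans; cong; cong₂; subst; subst₂; module ≡-Reasoning)
open import Relation.Nullary using (does; yes; no)

-- The isoperimetric inequality for `S` as a whole is too weak: at k = 2ⁿ⁻¹ it gives 2ⁿ T(1/2) =
-- 2ⁿ/2, while f(1/2) = 3/4. The cut along a half plane of count t gains the missing amount. The
-- midpoint inequality for T does not follow from itself by induction. For a and b in the same half
-- of [0, 1] it repeats one scale further down, but when they straddle 1/2 the linear parts cancel
-- and what is left is T(a + b) ≤ T(a) + T(b) for the 1-periodic extension, at rescaled arguments.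
-- So subadditivity comes first. The final comparison uses the unit Q = 2ⁿ/4: since a ≤ 1/2, one
-- unfolding of T replaces a by 2a, which lies in [1/6, 29/48]. On the line b = 1/2 the claim
-- becomes T(2a) ≥ 1 - (16/7)(1 - 2a)², and other values of b are treated as deviations from that
-- case.

-- The Takagi function at dyadic points, scaled to natural numbers.

module Takagi where
  open import Data.Nat
  open import Data.Nat.Properties
  open import Data.Nat.Tactic.RingSolver using (solve)

  -- A certificate that c (y - x) = (q - p) + r, free of subtraction.
  ≤-by-certificate : ∀ c .{{_ : NonZero c}} {p q} x y r → p ≤ q → c * x + q + r ≡ c * y + p → x ≤ y
  ≤-by-certificate c {p} {q} x y r p≤q eq = *-cancelˡ-≤ c (+-cancelʳ-≤ q (c * x) (c * y) (begin
    c * x + q      ≤⟨ m≤m+n _ r ⟩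
    c * x + q + r  ≡⟨ eq ⟩
    c * y + p      ≤⟨ +-monoʳ-≤ (c * y) p≤q ⟩
    c * y + q      ∎))
    where open ≤-Reasoning

  ≡-by-certificate : ∀ {p q} x y → p ≡ q → x + q ≡ y + p → x ≡ y
  ≡-by-certificate {p} x y refl eq = +-cancelʳ-≡ p x y eq

  -- takagi n k = 2ⁿ T(k / 2ⁿ) for k ≤ 2ⁿ, where T is the Takagi function; other k give junk.
  takagi : ℕ → ℕ → ℕ
  takagi zero    k = 0
  takagi (suc n) k with k ≤? 2 ^ n
  ... | yes _ = k + takagi n k
  ... | no  _ = (2 ^ suc n ∸ k) + takagi n (k ∸ 2 ^ n)

  -- Records in which half of [0, 2ⁿ⁺¹] a number lies, with its complement given by an equation
  -- between sums: the ring solver can use that, unlike truncated subtraction. The constructors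
  -- overlap at the midpoint, where both branches of `takagi` agree.
  data Side (n : ℕ) : ℕ → Set where
    low  : ∀ {k} r → k + r ≡ 2 ^ n → Side n k
    high : ∀ j r → j + r ≡ 2 ^ n → Side n (2 ^ n + j)

  complement : ∀ {k m} → k ≤ m → ∃ λ r → k + r ≡ m
  complement {k} {m} k≤m = m ∸ k , m+[n∸m]≡n k≤m

  side : ∀ n {k} → k ≤ 2 ^ suc n → Side n k
  side n {k} k≤ with ≤-total k (2 ^ n)
  ... | inj₁ k≤P with r , eq ← complement k≤P = low r eq
  ... | inj₂ P≤k with j , refl ← complement P≤k | r , eq ← complement k≤ = high j r
    (+-cancelˡ-≡ (2 ^ n) _ _ (trans (sym (+-assoc (2 ^ n) j r)) (trans eq (cong (2 ^ n +_) (+-identityʳ (2 ^ n))))))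

  takagi-low≤ : ∀ n {k} → k ≤ 2 ^ n → takagi (suc n) k ≡ k + takagi n k
  takagi-low≤ n {k} k≤ with k ≤? 2 ^ n
  ... | yes _ = refl
  ... | no k≰ = ⊥-elim (k≰ k≤)

  takagi-low : ∀ n k r → k + r ≡ 2 ^ n → takagi (suc n) k ≡ k + takagi n k
  takagi-low n k r eq = takagi-low≤ n (subst (k ≤_) eq (m≤m+n k r))

  takagi-0 : ∀ n → takagi n 0 ≡ 0
  takagi-0 zero = refl
  takagi-0 (suc n) = trans (takagi-low≤ n z≤n) (takagi-0 n)

  takagi-top : ∀ n → takagi n (2 ^ n) ≡ 0
  takagi-top zero = refl
  takagi-top (suc n) with 2 ^ suc n ≤? 2 ^ n
  ... | yes le = ⊥-elim (<⇒≱ (m<m+n (2 ^ n) (subst (0 <_) (sym (+-identityʳ _)) (m^n>0 2 n))) le)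
  ... | no _ rewrite n∸n≡0 (2 ^ suc n) | m+n∸m≡n (2 ^ n) (2 ^ n + 0) | +-identityʳ (2 ^ n) = takagi-top n

  takagi-high : ∀ n j r → j + r ≡ 2 ^ n → takagi (suc n) (2 ^ n + j) ≡ r + takagi n j
  takagi-high n j r eq with 2 ^ n + j ≤? 2 ^ n
  -- At the midpoint `takagi` takes its first branch; the two formulas agree because T vanishes at
  -- both 0 and 1.
  takagi-high n zero r eq | yes _ rewrite +-identityʳ (2 ^ n) | takagi-top n | takagi-0 n = cong (_+ 0) (sym eq)
  takagi-high n (suc j) r eq | yes le = ⊥-elim (<⇒≱ (m<m+n (2 ^ n) (s≤s z≤n)) le)
  ... | no _ = cong₂ _+_ (trans (cong (_∸ (2 ^ n + j)) double) (m+n∸m≡n (2 ^ n + j) r)) (cong (takagi n) (m+n∸m≡n (2 ^ n) j))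
    where
    double : 2 ^ suc n ≡ 2 ^ n + j + r
    double = trans (cong (2 ^ n +_) (trans (+-identityʳ _) (sym eq))) (sym (+-assoc (2 ^ n) j r))

  ≤-resp-≡ : ∀ {x x′ y y′} → x ≡ x′ → y ≡ y′ → x′ ≤ y′ → x ≤ y
  ≤-resp-≡ refl refl x≤y = x≤y

  takagi-sym : ∀ n a b → a + b ≡ 2 ^ n → takagi n a ≡ takagi n b
  takagi-sym zero a b eq = refl
  takagi-sym (suc n) a b eq with side n (subst (a ≤_) eq (m≤m+n a b))
  ... | low r er = begin
      takagi (suc n) a            ≡⟨ takagi-low n a r er ⟩
      a + takagi n a              ≡⟨ cong (a +_) (takagi-sym n a r er) ⟩
      a + takagi n r              ≡⟨ takagi-high n r a (trans (+-comm r a) er) ⟨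
      takagi (suc n) (2 ^ n + r)  ≡⟨ cong (takagi (suc n)) (b≡ (2 ^ n) eq er) ⟨
      takagi (suc n) b            ∎
    where
    open ≡-Reasoning
    b≡ : ∀ P → a + b ≡ 2 * P → a + r ≡ P → b ≡ P + r
    b≡ P eq er = ≡-by-certificate b (P + r) (cong₂ _+_ eq (sym er)) (solve (P ∷ a ∷ b ∷ r ∷ []))
  ... | high j r er = begin
      takagi (suc n) (2 ^ n + j)  ≡⟨ takagi-high n j b j+b ⟩
      b + takagi n j              ≡⟨ cong (b +_) (takagi-sym n j b j+b) ⟩
      b + takagi n b              ≡⟨ takagi-low n b j (trans (+-comm b j) j+b) ⟨
      takagi (suc n) b            ∎
    where
    open ≡-Reasoning
    cancel : ∀ P → P + j + b ≡ 2 * P → j + b ≡ P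
    cancel P eq = ≡-by-certificate (j + b) P eq (solve (P ∷ j ∷ b ∷ []))
    j+b : j + b ≡ 2 ^ n
    j+b = cancel (2 ^ n) eq

  -- Subadditivity and the midpoint inequality.

  -- The periodic extension of T is even and subadditive; a + b + c ≡ 2ⁿ says c ≡ -(a + b) modulo the period.
  takagi-subadditive : ∀ n a b c → a + b + c ≡ 2 ^ n → takagi n c ≤ takagi n a + takagi n b
  takagi-subadditive zero a b c eq = z≤n
  takagi-subadditive (suc n) a b c eq with side n (subst (c ≤_) eq (m≤n+m c (a + b)))
  ... | high j u eu =
      ≤-resp-≡ (takagi-high n j (a + b) (trans (+-comm j (a + b)) sum))
               (cong₂ _+_ (takagi-low n a (b + j) (trans (sym (+-assoc a b j)) sum)) (takagi-low n b (a + j) (trans rotate sum)))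
        (add (takagi n a) (takagi n b) (takagi n j) (takagi-subadditive n a b j sum))
    where
    cancel : ∀ P → a + b + (P + j) ≡ 2 * P → a + b + j ≡ P
    cancel P eq = ≡-by-certificate (a + b + j) P eq (solve (P ∷ a ∷ b ∷ j ∷ []))
    sum : a + b + j ≡ 2 ^ n
    sum = cancel (2 ^ n) eq
    rotate : b + (a + j) ≡ a + b + j
    rotate = solve (a ∷ b ∷ j ∷ [])
    add : ∀ x y z → z ≤ x + y → a + b + z ≤ a + x + (b + y)
    add x y z le = ≤-by-certificate 1 (a + b + z) (a + x + (b + y)) 0 le (solve (a ∷ b ∷ x ∷ y ∷ z ∷ []))
  ... | low u eu with side n (subst (a ≤_) eq (≤-trans (m≤m+n a b) (m≤m+n (a + b) c)))
  ... | high i r er =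
      ≤-resp-≡ (takagi-low n c u eu)
               (cong₂ _+_ (takagi-high n i (b + c) (trans (sym (+-assoc i b c)) sum)) (takagi-low n b (i + c) (trans rotate sum)))
        (add (takagi n i) (takagi n b) (takagi n c) (takagi-subadditive n i b c sum))
    where
    cancel : ∀ P → P + i + b + c ≡ 2 * P → i + b + c ≡ P
    cancel P eq = ≡-by-certificate (i + b + c) P eq (solve (P ∷ i ∷ b ∷ c ∷ []))
    sum : i + b + c ≡ 2 ^ n
    sum = cancel (2 ^ n) eq
    rotate : b + (i + c) ≡ i + b + c
    rotate = solve (i ∷ b ∷ c ∷ [])
    add : ∀ x y z → z ≤ x + y → c + z ≤ b + c + x + (b + y)
    add x y z le = ≤-by-certificate 1 (c + z) (b + c + x + (b + y)) (2 * b) le (solve (b ∷ c ∷ x ∷ y ∷ z ∷ []))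
  ... | low r er with side n (subst (b ≤_) eq (≤-trans (m≤n+m b a) (m≤m+n (a + b) c)))
  ... | high j s es =
      ≤-resp-≡ (takagi-low n c u eu)
               (cong₂ _+_ (takagi-low n a r er) (takagi-high n j (a + c) (trans rotate sum)))
        (add (takagi n a) (takagi n j) (takagi n c) (takagi-subadditive n a j c sum))
    where
    cancel : ∀ P → a + (P + j) + c ≡ 2 * P → a + j + c ≡ P
    cancel P eq = ≡-by-certificate (a + j + c) P eq (solve (P ∷ a ∷ j ∷ c ∷ []))
    sum : a + j + c ≡ 2 ^ n
    sum = cancel (2 ^ n) eq
    rotate : j + (a + c) ≡ a + j + c
    rotate = solve (a ∷ j ∷ c ∷ [])
    add : ∀ x y z → z ≤ x + y → c + z ≤ a + x + (a + c + y)
    add x y z le = ≤-by-certificate 1 (c + z) (a + x + (a + c + y)) (2 * a) le (solve (a ∷ c ∷ x ∷ y ∷ z ∷ []))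
  -- No summand can be reduced by 2ⁿ here, but the three complements add up to 2ⁿ, so the induction
  -- hypothesis applies after reflection. The linear parts leave a + b - c = 2u ≥ 0.
  ... | low s es =
      ≤-resp-≡ (takagi-low n c u eu) (cong₂ _+_ (takagi-low n a r er) (takagi-low n b s es))
        (add (2 ^ n) (takagi n a) (takagi n b) (takagi n c) eq eu
          (≤-resp-≡ (takagi-sym n c u eu) (cong₂ _+_ (takagi-sym n a r er) (takagi-sym n b s es))
            (takagi-subadditive n r s u (complements (2 ^ n) eq er es eu))))
    where
    complements : ∀ P → a + b + c ≡ 2 * P → a + r ≡ P → b + s ≡ P → c + u ≡ P → r + s + u ≡ P
    complements P eq er es eu = ≡-by-certificate (r + s + u) P
      (cong₂ _+_ (cong₂ _+_ (cong₂ _+_ er es) eu) (sym eq)) (solve (P ∷ a ∷ b ∷ c ∷ r ∷ s ∷ u ∷ []))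
    add : ∀ P x y z → a + b + c ≡ 2 * P → c + u ≡ P → z ≤ x + y → c + z ≤ a + x + (b + y)
    add P x y z eq eu z≤ =
      ≤-by-certificate 1 (c + z) (a + x + (b + y)) (2 * u)
        (+-mono-≤ (+-mono-≤ z≤ (≤-reflexive (sym eq))) (≤-reflexive (cong (2 *_) eu)))
        (solve (P ∷ a ∷ b ∷ c ∷ u ∷ x ∷ y ∷ z ∷ []))

  -- When a and b lie in the same half, unfolding T once on each side leaves the same inequality one
  -- level down. When they lie in different halves, b = 2ⁿ + j, both sides equal 2ⁿ⁺¹ plus a Takagi
  -- term, and subadditivity at a, j compares those terms.
  takagi-midconvex : ∀ n a b → a ≤ b → b ≤ 2 ^ n → takagi (suc n) (a + b) + a ≤ takagi n a + takagi n b + b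
  takagi-midconvex zero zero zero a≤b b≤ = z≤n
  takagi-midconvex zero zero (suc zero) a≤b b≤ = ≤-refl
  takagi-midconvex zero (suc zero) (suc zero) a≤b b≤ = ≤-refl
  takagi-midconvex zero (suc (suc a)) (suc zero) (s≤s ()) b≤
  takagi-midconvex zero _ (suc (suc b)) a≤b (s≤s ())
  takagi-midconvex (suc n) a b a≤b b≤ with side n b≤
  ... | low s es with r , er ← complement (≤-trans a≤b (subst (b ≤_) es (m≤m+n b s))) =
      ≤-resp-≡ (cong (_+ a) (takagi-low (suc n) (a + b) (r + s) (sum (2 ^ n) er es)))
               (cong (_+ b) (cong₂ _+_ (takagi-low n a r er) (takagi-low n b s es)))
        (add (takagi n a) (takagi n b) (takagi (suc n) (a + b)) (takagi-midconvex n a b a≤b (subst (b ≤_) es (m≤m+n b s))))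
    where
    sum : ∀ P → a + r ≡ P → b + s ≡ P → a + b + (r + s) ≡ 2 * P
    sum P er es = ≡-by-certificate (a + b + (r + s)) (2 * P) (cong₂ _+_ er es) (solve (P ∷ a ∷ b ∷ r ∷ s ∷ []))
    add : ∀ x y z → z + a ≤ x + y + b → a + b + z + a ≤ a + x + (b + y) + b
    add x y z le = ≤-by-certificate 1 (a + b + z + a) (a + x + (b + y) + b) 0 le (solve (a ∷ b ∷ x ∷ y ∷ z ∷ []))
  ... | high j s es with side n (≤-trans a≤b b≤)
  ... | high i r er =
      ≤-resp-≡ (cong (_+ (2 ^ n + i)) (trans (cong (takagi (suc (suc n))) (regroup (2 ^ n)))
                 (takagi-high (suc n) (i + j) (r + s) (sum (2 ^ n) er es))))
               (cong (_+ (2 ^ n + j)) (cong₂ _+_ (takagi-high n i r er) (takagi-high n j s es)))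
        (add (2 ^ n) (takagi n i) (takagi n j) (takagi (suc n) (i + j))
          (takagi-midconvex n i j (+-cancelˡ-≤ (2 ^ n) _ _ a≤b) (subst (j ≤_) es (m≤m+n j s))))
    where
    regroup : ∀ P → P + i + (P + j) ≡ 2 * P + (i + j)
    regroup P = solve (P ∷ i ∷ j ∷ [])
    sum : ∀ P → i + r ≡ P → j + s ≡ P → i + j + (r + s) ≡ 2 * P
    sum P er es = ≡-by-certificate (i + j + (r + s)) (2 * P) (cong₂ _+_ er es) (solve (P ∷ i ∷ j ∷ r ∷ s ∷ []))
    add : ∀ P x y z → z + i ≤ x + y + j → r + s + z + (P + i) ≤ r + x + (s + y) + (P + j)
    add P x y z le =
      ≤-by-certificate 1 (r + s + z + (P + i)) (r + x + (s + y) + (P + j)) 0 le (solve (P ∷ i ∷ j ∷ r ∷ s ∷ x ∷ y ∷ z ∷ []))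
  -- The two cases are whether a + j stays within one period 2ⁿ or wraps around; in the second the
  -- remainder is c, and subadditivity is applied to the reflected arguments.
  ... | low r er with ≤-total (a + j) (2 ^ n)
  ... | inj₁ a+j≤P with u , eu ← complement a+j≤P =
      ≤-resp-≡ (cong (_+ a) (trans (takagi-low (suc n) (a + (2 ^ n + j)) u (sum (2 ^ n) eu)) (cong (a + (2 ^ n + j) +_)
                 (trans (cong (takagi (suc n)) (regroup (2 ^ n)))
                 (trans (takagi-high n (a + j) u eu) (cong (u +_) (takagi-sym n (a + j) u eu)))))))
               (cong (_+ (2 ^ n + j)) (cong₂ _+_ (takagi-low n a r er) (takagi-high n j s es)))
        (add (2 ^ n) (takagi n a) (takagi n j) (takagi n u) es eu (takagi-subadditive n a j u eu))
    where
    regroup : ∀ P → a + (P + j) ≡ P + (a + j)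
    regroup P = solve (P ∷ a ∷ j ∷ [])
    sum : ∀ P → a + j + u ≡ P → a + (P + j) + u ≡ 2 * P
    sum P eu = ≡-by-certificate (a + (P + j) + u) (2 * P) eu (solve (P ∷ a ∷ j ∷ u ∷ []))
    add : ∀ P x y z → j + s ≡ P → a + j + u ≡ P → z ≤ x + y →
          a + (P + j) + (u + z) + a ≤ a + x + (s + y) + (P + j)
    add P x y z es eu le =
      ≤-by-certificate 1 (a + (P + j) + (u + z) + a) (a + x + (s + y) + (P + j)) 0
        (+-mono-≤ (+-mono-≤ le (≤-reflexive (sym es))) (≤-reflexive eu)) (solve (P ∷ a ∷ j ∷ s ∷ u ∷ x ∷ y ∷ z ∷ []))
  ... | inj₂ P≤a+j with c , ec ← complement P≤a+j =
      ≤-resp-≡ (cong (_+ a) (trans (cong (takagi (suc (suc n))) (regroup (2 ^ n) ec))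
                 (trans (takagi-high (suc n) c (r + s + 2 ^ n) (sum (2 ^ n) ec er es))
                 (cong (r + s + 2 ^ n +_) (takagi-low n c (r + s) (trans (+-comm c (r + s)) (complements (2 ^ n) ec er es)))))))
               (cong (_+ (2 ^ n + j)) (cong₂ _+_ (takagi-low n a r er) (takagi-high n j s es)))
        (add (2 ^ n) (takagi n a) (takagi n j) (takagi n c) ec er
          (≤-resp-≡ refl (cong₂ _+_ (takagi-sym n a r er) (takagi-sym n j s es))
            (takagi-subadditive n r s c (complements (2 ^ n) ec er es))))
    where
    regroup : ∀ P → P + c ≡ a + j → a + (P + j) ≡ 2 * P + c
    regroup P ec = ≡-by-certificate (a + (P + j)) (2 * P + c) (sym ec) (solve (P ∷ a ∷ j ∷ c ∷ []))
    complements : ∀ P → P + c ≡ a + j → a + r ≡ P → j + s ≡ P → r + s + c ≡ P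
    complements P ec er es =
      ≡-by-certificate (r + s + c) P (cong₂ _+_ (cong₂ _+_ ec er) es) (solve (P ∷ a ∷ j ∷ c ∷ r ∷ s ∷ []))
    sum : ∀ P → P + c ≡ a + j → a + r ≡ P → j + s ≡ P → c + (r + s + P) ≡ 2 * P
    sum P ec er es =
      ≡-by-certificate (c + (r + s + P)) (2 * P) (cong₂ _+_ (cong₂ _+_ ec er) es) (solve (P ∷ a ∷ j ∷ c ∷ r ∷ s ∷ []))
    add : ∀ P x y z → P + c ≡ a + j → a + r ≡ P → z ≤ x + y →
          r + s + P + (c + z) + a ≤ a + x + (s + y) + (P + j)
    add P x y z ec er le =
      ≤-by-certificate 1 (r + s + P + (c + z) + a) (a + x + (s + y) + (P + j)) 0
        (+-mono-≤ (+-mono-≤ le (≤-reflexive ec)) (≤-reflexive er)) (solve (P ∷ a ∷ j ∷ c ∷ r ∷ s ∷ x ∷ y ∷ z ∷ []))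

  -- Linear and constant lower bounds for T.

  -- *-monoʳ-≤ with its type β-reduced, as the ring solver needs it.
  scale : ∀ c {m n} → m ≤ n → c * m ≤ c * n
  scale c m≤n = *-monoʳ-≤ c m≤n

  -- (q - p) (q′ - p′) ≥ 0
  *-slacks-nonneg : ∀ {p q p′ q′} → p ≤ q → p′ ≤ q′ → p * q′ + q * p′ ≤ p * p′ + q * q′
  *-slacks-nonneg {p} {q} {p′} {q′} p≤q p′≤q′ with v , refl ← complement p≤q | w , refl ← complement p′≤q′ =
    ≤-by-certificate 1 (p * (p′ + w) + (p + v) * p′) (p * p′ + (p + v) * (p′ + w)) (v * w) (z≤n {0})
      (solve (p ∷ p′ ∷ v ∷ w ∷ []))

  k≤m-by-scaling : ∀ c d .{{_ : NonZero c}} {k m} → d ≤ c → c * k ≤ d * m → k ≤ m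
  k≤m-by-scaling c d {k} {m} d≤c ck≤dm = *-cancelˡ-≤ c (≤-trans ck≤dm (*-monoˡ-≤ m d≤c))

  mutual
    -- T(x) ≥ x on [0, 2/3] and T(x) ≥ 2x on [0, 1/3] support each other. On [0, 1/2] the first is
    -- immediate; beyond, with v = 2x - 1 ≤ 1/3, T(x) - x = (T(v) - 2v)/2 reduces it to the second.
    -- Doubling the argument reduces the second to the first.
    k≤takagi : ∀ n k → 3 * k ≤ 2 * 2 ^ n → k ≤ takagi n k
    k≤takagi zero zero 3k≤ = z≤n
    k≤takagi zero (suc k) 3k≤ = ⊥-elim (<⇒≱ (s≤s (s≤s (s≤s z≤n))) (≤-trans (scale 3 {1} (s≤s z≤n)) 3k≤))
    k≤takagi (suc n) k 3k≤ with side n (k≤m-by-scaling 3 2 (m≤m+n 2 1) 3k≤)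
    ... | low r er = subst (k ≤_) (sym (takagi-low n k r er)) (m≤m+n k _)
    ... | high j r er = subst (2 ^ n + j ≤_) (sym (takagi-high n j r er))
        (add (2 ^ n) (takagi n j) er (2k≤takagi n j (3j≤ (2 ^ n) 3k≤)))
      where
      3j≤ : ∀ P → 3 * (P + j) ≤ 2 * (2 * P) → 3 * j ≤ P
      3j≤ P le = ≤-by-certificate 1 (3 * j) P 0 le (solve (P ∷ j ∷ []))
      add : ∀ P x → j + r ≡ P → 2 * j ≤ x → P + j ≤ r + x
      add P x refl le = ≤-by-certificate 1 (j + r + j) (r + x) 0 le (solve (j ∷ r ∷ x ∷ []))

    2k≤takagi : ∀ n k → 3 * k ≤ 2 ^ n → 2 * k ≤ takagi n k
    2k≤takagi zero zero 3k≤ = z≤n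
    2k≤takagi zero (suc k) 3k≤ = ⊥-elim (<⇒≱ (s≤s (s≤s z≤n)) (≤-trans (scale 3 {1} (s≤s z≤n)) 3k≤))
    2k≤takagi (suc n) k 3k≤ with r , er ← complement (k≤m-by-scaling 3 2 {k} {2 ^ n} (m≤m+n 2 1) 3k≤) =
      ≤-resp-≡ (cong (k +_) (+-identityʳ k)) (takagi-low n k r er) (+-monoʳ-≤ k (k≤takagi n k 3k≤))

  3k≤takagi : ∀ n k → 6 * k ≤ 2 ^ n → 3 * k ≤ takagi n k
  3k≤takagi zero zero 6k≤ = z≤n
  3k≤takagi zero (suc k) 6k≤ = ⊥-elim (<⇒≱ (s≤s (s≤s z≤n)) (≤-trans (scale 6 {1} (s≤s z≤n)) 6k≤))
  3k≤takagi (suc n) k 6k≤ with r , er ← complement (k≤m-by-scaling 6 2 {k} {2 ^ n} (m≤m+n 2 4) 6k≤) =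
     subst (3 * k ≤_) (sym (takagi-low n k r er)) (+-monoʳ-≤ k (2k≤takagi n k (3k≤P (2 ^ n) 6k≤)))
    where
    3k≤P : ∀ P → 6 * k ≤ 2 * P → 3 * k ≤ P
    3k≤P P 6k≤ = ≤-by-certificate 2 (3 * k) P 0 6k≤ (solve (P ∷ k ∷ []))

  -- For x ≤ 1/2, T(x) = x + T(1 - 2x)/2 ≥ x + (1 - 2x)/2 = 1/2, as x ≥ 1/6 puts 1 - 2x below 2/3.
  -- The upper half is the mirror image.
  ½≤takagi : ∀ n k → 2 ^ n ≤ 6 * k → 6 * k ≤ 5 * 2 ^ n → 2 ^ n ≤ 2 * takagi n k
  ½≤takagi zero zero () _
  ½≤takagi zero (suc k) _ 6k≤ = ⊥-elim (<⇒≱ (s≤s (s≤s (s≤s (s≤s (s≤s (s≤s z≤n)))))) (≤-trans (scale 6 {1} (s≤s z≤n)) 6k≤))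
  ½≤takagi (suc n) k ≤6k 6k≤ with side n (k≤m-by-scaling 6 5 (m≤m+n 5 1) 6k≤)
  ... | low r er = subst (λ v → 2 ^ suc n ≤ 2 * v) (sym (takagi-low n k r er)) (scale 2
        (subst (_≤ k + takagi n k) er (+-monoʳ-≤ k (subst (r ≤_) (sym (takagi-sym n k r er)) (k≤takagi n r (3r≤ (2 ^ n) er ≤6k))))))
    where
    3r≤ : ∀ P → k + r ≡ P → 2 * P ≤ 6 * k → 3 * r ≤ 2 * P
    3r≤ P refl le = ≤-by-certificate 2 (3 * r) (2 * (k + r)) 0 le (solve (k ∷ r ∷ []))
  ... | high j r er = subst (λ v → 2 ^ suc n ≤ 2 * v) (sym (takagi-high n j r er)) (scale 2
        (subst (_≤ r + takagi n j) (trans (+-comm r j) er) (+-monoʳ-≤ r (k≤takagi n j (3j≤ (2 ^ n) 6k≤)))))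
    where
    3j≤ : ∀ P → 6 * (P + j) ≤ 5 * (2 * P) → 3 * j ≤ 2 * P
    3j≤ P le = ≤-by-certificate 2 (3 * j) (2 * P) 0 le (solve (P ∷ j ∷ []))

  -- The comparison with the parabola f.

  -- T(y) ≥ 1 - (16/7) (1 - y)² for 1/6 ≤ y ≤ 29/48: the case k - t = 2ⁿ / 4.
  takagi-parabola : ∀ n t t′ → let Q = 2 ^ suc n in t + t′ ≡ Q → Q ≤ 6 * t → 48 * t ≤ 29 * Q →
                    7 * (Q * Q) ≤ 7 * (Q * takagi (suc n) t) + 16 * (t′ * t′)
  -- For y ≤ 17/32 the bound T ≥ 1/2 is enough, since (16/7)(15/32)² = 225/448 just exceeds 1/2.
  takagi-parabola n t t′ eq Q≤6t 48t≤29Q with ≤-total (32 * t) (17 * 2 ^ suc n)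
  ... | inj₁ 32t≤17Q = bound (2 ^ suc n) (takagi (suc n) t) (15Q≤32t′ (2 ^ suc n) eq 32t≤17Q)
        (½≤takagi (suc n) t Q≤6t (6t≤5Q (2 ^ suc n) 48t≤29Q))
    where
    6t≤5Q : ∀ Q → 48 * t ≤ 29 * Q → 6 * t ≤ 5 * Q
    6t≤5Q Q le = ≤-by-certificate 8 (6 * t) (5 * Q) (11 * Q) le (solve (Q ∷ t ∷ []))
    15Q≤32t′ : ∀ Q → t + t′ ≡ Q → 32 * t ≤ 17 * Q → 15 * Q ≤ 32 * t′
    15Q≤32t′ Q refl le = ≤-by-certificate 1 (15 * (t + t′)) (32 * t′) 0 le (solve (t ∷ t′ ∷ []))
    bound : ∀ Q x → 15 * Q ≤ 32 * t′ → Q ≤ 2 * x → 7 * (Q * Q) ≤ 7 * (Q * x) + 16 * (t′ * t′)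
    bound Q x h Q≤2x = ≤-by-certificate 64 (7 * (Q * Q)) (7 * (Q * x) + 16 * (t′ * t′)) (Q * Q)
      (+-mono-≤ (scale (224 * Q) Q≤2x) (*-mono-≤ h h)) (solve (Q ∷ x ∷ t′ ∷ []))
  ... | inj₂ 17Q≤32t with side n (subst (t ≤_) eq (m≤m+n t t′))
  ... | low r er = ⊥-elim (<⇒≱ (m^n>0 2 n) (P≤0 (2 ^ n) er 17Q≤32t))
    where
    P≤0 : ∀ P → t + r ≡ P → 17 * (2 * P) ≤ 32 * t → P ≤ 0
    P≤0 P refl le = ≤-by-certificate 2 (t + r) 0 (32 * r) le (solve (t ∷ r ∷ []))
  ... | high u u′ eu = subst₂ (λ v w → 7 * (2 ^ suc n * 2 ^ suc n) ≤ 7 * (2 ^ suc n * v) + 16 * (w * w))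
        (sym (takagi-high n u u′ eu)) (sym (t′≡u′ (2 ^ n) eq eu)) (cases (≤-total (6 * u) (2 ^ n)))
    where
    t′≡u′ : ∀ P → P + u + t′ ≡ 2 * P → u + u′ ≡ P → t′ ≡ u′
    t′≡u′ P eq refl = ≡-by-certificate t′ u′ eq (solve (u ∷ u′ ∷ t′ ∷ []))
    6u≤5P : ∀ P → 48 * (P + u) ≤ 29 * (2 * P) → 6 * u ≤ 5 * P
    6u≤5P P le = ≤-by-certificate 8 (6 * u) (5 * P) (30 * P) le (solve (P ∷ u ∷ []))
    19u≤5u′ : ∀ P → u + u′ ≡ P → 48 * (P + u) ≤ 29 * (2 * P) → 19 * u ≤ 5 * u′
    19u≤5u′ P refl le = ≤-by-certificate 2 (19 * u) (5 * u′) 0 le (solve (u ∷ u′ ∷ []))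
    -- After replacing x by 3u the difference of the two sides is `14 u² + 2 u′²`, a sum of squares.
    near-½ : ∀ P x → u + u′ ≡ P → 3 * u ≤ x → 7 * (2 * P * (2 * P)) ≤ 7 * (2 * P * (u′ + x)) + 16 * (u′ * u′)
    near-½ P x refl 3u≤x =
      ≤-by-certificate 1 (7 * (2 * (u + u′) * (2 * (u + u′)))) (7 * (2 * (u + u′) * (u′ + x)) + 16 * (u′ * u′))
        (14 * (u * u) + 2 * (u′ * u′)) (scale (14 * (u + u′)) 3u≤x) (solve (u ∷ u′ ∷ x ∷ []))
    -- Here T(y) ≥ (1 - y) + 1/4, which dominates the parabola once 1 - y exceeds about 0.3945. The
    -- upper bound on t gives 1 - y ≥ 19/48, about 0.3958, so there is little room.
    beyond : ∀ P x → u + u′ ≡ P → 19 * u ≤ 5 * u′ → P ≤ 2 * x →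
             7 * (2 * P * (2 * P)) ≤ 7 * (2 * P * (u′ + x)) + 16 * (u′ * u′)
    beyond P x refl h P≤2x =
      ≤-by-certificate 50 (7 * (2 * (u + u′) * (2 * (u + u′)))) (7 * (2 * (u + u′) * (u′ + x)) + 16 * (u′ * u′)) (128 * (u * u))
        (+-mono-≤ (+-mono-≤ (scale (350 * (u + u′)) P≤2x) (scale (404 * u) h)) (scale 18 (*-slacks-nonneg h h)))
        (solve (u ∷ u′ ∷ x ∷ []))
    cases : (6 * u ≤ 2 ^ n) ⊎ (2 ^ n ≤ 6 * u) →
            7 * (2 ^ suc n * 2 ^ suc n) ≤ 7 * (2 ^ suc n * (u′ + takagi n u)) + 16 * (u′ * u′)
    cases (inj₁ 6u≤P) = near-½ (2 ^ n) (takagi n u) eu (3k≤takagi n u 6u≤P)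
    cases (inj₂ P≤6u) = beyond (2 ^ n) (takagi n u) eu (19u≤5u′ (2 ^ n) eu 48t≤29Q)
      (½≤takagi n u P≤6u (6u≤5P (2 ^ n) 48t≤29Q))

  module LowerHalf (Q x y t t′ s p e θ : ℕ) where
    e≡t′+p : s + t + e ≡ 2 * Q → t + t′ ≡ Q → s + p ≡ Q → e ≡ t′ + p
    e≡t′+p sum et ep = ≡-by-certificate e (t′ + p) (cong₂ _+_ (cong₂ _+_ sum (sym et)) (sym ep))
      (solve (Q ∷ t ∷ t′ ∷ s ∷ p ∷ e ∷ []))

    19Q≤48t′ : t + t′ ≡ Q → 48 * t ≤ 29 * Q → 19 * Q ≤ 48 * t′
    19Q≤48t′ et le = ≤-by-certificate 1 (19 * Q) (48 * t′) 0
      (+-mono-≤ le (≤-reflexive (cong (48 *_) (sym et)))) (solve (Q ∷ t ∷ t′ ∷ []))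

    3p≤2Q : 2 * p ≤ Q → 3 * p ≤ 2 * Q
    3p≤2Q le = ≤-by-certificate 2 (3 * p) (2 * Q) Q (scale 3 le) (solve (Q ∷ p ∷ []))

    -- With Q as unit and the parabola bound subtracted, `7y - 14p + 32t′p + 16p² ≥ 0` remains. As
    -- t′ ≥ 19/48, the two middle terms lose at most 4p/3, which 7y ≥ 7p covers.
    small-p : s + p ≡ Q → 19 * Q ≤ 48 * t′ → 7 * (Q * Q) ≤ 7 * (Q * x) + 16 * (t′ * t′) →
              t + x + (s + y) + s ≤ θ + t → p ≤ y → 21 * (Q * Q) ≤ 7 * (Q * θ) + 16 * ((t′ + p) * (t′ + p))
    small-p ep h k le p≤y = ≤-by-certificate 3 (21 * (Q * Q)) (7 * (Q * θ) + 16 * ((t′ + p) * (t′ + p)))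
      (17 * (Q * p) + 48 * (p * p))
      (+-mono-≤ (+-mono-≤ (+-mono-≤ (+-mono-≤ (scale (2 * p) h) (scale 3 k)) (scale (21 * Q) le))
        (scale (21 * Q) p≤y)) (≤-reflexive (cong (42 * Q *_) (sym ep))))
      (solve (Q ∷ x ∷ y ∷ t ∷ t′ ∷ s ∷ p ∷ θ ∷ []))

    -- The same loss of at most 4p/3 is now covered by 16p² ≥ 8p.
    large-p : s + p ≡ Q → 19 * Q ≤ 48 * t′ → 7 * (Q * Q) ≤ 7 * (Q * x) + 16 * (t′ * t′) →
              t + x + (s + y) + s ≤ θ + t → Q ≤ 2 * p → 21 * (Q * Q) ≤ 7 * (Q * θ) + 16 * ((t′ + p) * (t′ + p))
    large-p ep h k le Q≤2p = ≤-by-certificate 3 (21 * (Q * Q)) (7 * (Q * θ) + 16 * ((t′ + p) * (t′ + p)))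
      (20 * (Q * p) + 21 * (Q * y))
      (+-mono-≤ (+-mono-≤ (+-mono-≤ (+-mono-≤ (scale (2 * p) h) (scale 3 k)) (scale (21 * Q) le))
        (scale (24 * p) Q≤2p)) (≤-reflexive (cong (42 * Q *_) (sym ep))))
      (solve (Q ∷ x ∷ y ∷ t ∷ t′ ∷ s ∷ p ∷ θ ∷ []))

  module UpperHalf (Q x y t t′ j j′ e θ : ℕ) where
    6j≤5Q : Q + j + t + e ≡ 2 * Q → Q ≤ 6 * t → 6 * j ≤ 5 * Q
    6j≤5Q sum le = ≤-by-certificate 1 (6 * j) (5 * Q) (6 * e)
      (+-mono-≤ le (≤-reflexive (cong (6 *_) sum))) (solve (Q ∷ t ∷ j ∷ e ∷ []))

    Q≤6j : j + j′ ≡ Q → 6 * j′ ≤ 5 * Q → Q ≤ 6 * j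
    Q≤6j ej le = ≤-by-certificate 1 Q (6 * j) 0
      (+-mono-≤ le (≤-reflexive (cong (6 *_) (sym ej)))) (solve (Q ∷ j ∷ j′ ∷ []))

    6j≤Q : j + j′ ≡ Q → 5 * Q ≤ 6 * j′ → 6 * j ≤ Q
    6j≤Q ej le = ≤-by-certificate 1 (6 * j) Q 0
      (+-mono-≤ le (≤-reflexive (cong (6 *_) ej))) (solve (Q ∷ j ∷ j′ ∷ []))

    6t≤5Q : 48 * t ≤ 29 * Q → 6 * t ≤ 5 * Q
    6t≤5Q le = ≤-by-certificate 8 (6 * t) (5 * Q) (11 * Q) le (solve (Q ∷ t ∷ []))

    47Q≤96e : j + j′ ≡ Q → Q + j + t + e ≡ 2 * Q → 5 * Q ≤ 6 * j′ → 32 * t ≤ 11 * Q → 47 * Q ≤ 96 * e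
    47Q≤96e ej sum h h′ = ≤-by-certificate 1 (47 * Q) (96 * e) 0
      (+-mono-≤ (+-mono-≤ (+-mono-≤ (scale 16 h) (scale 3 h′)) (≤-reflexive (cong (96 *_) ej)))
        (≤-reflexive (cong (96 *_) (sym sum))))
      (solve (Q ∷ t ∷ j ∷ j′ ∷ e ∷ []))

    t′≡e+j : Q + j + t + e ≡ 2 * Q → t + t′ ≡ Q → t′ ≡ e + j
    t′≡e+j sum et = ≡-by-certificate t′ (e + j) (cong₂ _+_ et (sym sum)) (solve (Q ∷ t ∷ t′ ∷ j ∷ e ∷ []))

    32t′≤21Q : t + t′ ≡ Q → 11 * Q ≤ 32 * t → 32 * t′ ≤ 21 * Q
    32t′≤21Q et le = ≤-by-certificate 1 (32 * t′) (21 * Q) 0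
      (+-mono-≤ le (≤-reflexive (cong (32 *_) et))) (solve (Q ∷ t ∷ t′ ∷ []))

    -- The linear terms j′ + Q + j add up to exactly 2Q, which accounts for two thirds of the left
    -- side.
    reduce : j + j′ ≡ Q → t + x + (j′ + y) + (Q + j) ≤ θ + t → 7 * (Q * Q) ≤ 7 * (Q * (x + y)) + 16 * (e * e) →
             21 * (Q * Q) ≤ 7 * (Q * θ) + 16 * (e * e)
    reduce ej le h = ≤-by-certificate 1 (21 * (Q * Q)) (7 * (Q * θ) + 16 * (e * e)) 0
      (+-mono-≤ (+-mono-≤ (scale (7 * Q) le) h) (≤-reflexive (cong (7 * Q *_) (sym ej))))
      (solve (Q ∷ x ∷ y ∷ t ∷ j ∷ j′ ∷ e ∷ θ ∷ []))

    both-½ : Q ≤ 2 * x → Q ≤ 2 * y → 7 * (Q * Q) ≤ 7 * (Q * (x + y)) + 16 * (e * e)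
    both-½ h h′ = ≤-by-certificate 2 (7 * (Q * Q)) (7 * (Q * (x + y)) + 16 * (e * e)) (32 * (e * e))
      (scale (7 * Q) (+-mono-≤ h h′)) (solve (Q ∷ x ∷ y ∷ e ∷ []))

    -- In units of Q, j ≤ 1/6 and t ≤ 11/32 leave e ≥ 1 - 1/6 - 11/32 = 47/96. Then 16e² > 7/2, and
    -- 7x ≥ 7/2 supplies the rest.
    small-t : 47 * Q ≤ 96 * e → Q ≤ 2 * x → 7 * (Q * Q) ≤ 7 * (Q * (x + y)) + 16 * (e * e)
    small-t h h′ = ≤-by-certificate 576 (7 * (Q * Q)) (7 * (Q * (x + y)) + 16 * (e * e)) (193 * (Q * Q) + 4032 * (Q * y))
      (+-mono-≤ (scale (2016 * Q) h′) (*-mono-≤ h h)) (solve (Q ∷ x ∷ y ∷ e ∷ []))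

    -- Passing from (e + j)² to e² costs 32(e + j)j - 16j², at most 21j in units of Q, and 7y ≥ 21j
    -- pays for it. This fixes the threshold 11/32 for t: it is where t′ = e + j reaches 21/32.
    large-t : 32 * (e + j) ≤ 21 * Q → 3 * j ≤ y → 7 * (Q * Q) ≤ 7 * (Q * x) + 16 * ((e + j) * (e + j)) →
              7 * (Q * Q) ≤ 7 * (Q * (x + y)) + 16 * (e * e)
    large-t h h′ k = ≤-by-certificate 1 (7 * (Q * Q)) (7 * (Q * (x + y)) + 16 * (e * e)) (16 * (j * j))
      (+-mono-≤ (+-mono-≤ k (scale j h)) (scale (7 * Q) h′)) (solve (Q ∷ x ∷ y ∷ e ∷ j ∷ []))

  -- The Takagi form of the theorem: Q = 2ⁿ / 4, and e = 2Q - k measures the distance of k from 2ⁿ / 2.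
  split-inequality : ∀ n t s e θ → let Q = 2 ^ suc n in
    s + t + e ≡ 2 * Q → Q ≤ 6 * t → 48 * t ≤ 29 * Q →
    takagi (suc (suc n)) t + takagi (suc (suc n)) s + s ≤ θ + t →
    21 * (Q * Q) ≤ 7 * (Q * θ) + 16 * (e * e)
  split-inequality n t s e θ sum Q≤6t 48t≤29Q θ≥ =
    cases (complement (k≤m-by-scaling 48 29 (m≤m+n 29 19) 48t≤29Q))
          (side (suc n) (subst (s ≤_) sum (≤-trans (m≤m+n s t) (m≤m+n (s + t) e)))) sum θ≥
    where
    Q x : ℕ
    Q = 2 ^ suc n
    x = takagi (suc n) t
    cases : ∀ {s} → (∃ λ t′ → t + t′ ≡ Q) → Side (suc n) s → s + t + e ≡ 2 * Q →
            takagi (suc (suc n)) t + takagi (suc (suc n)) s + s ≤ θ + t → 21 * (Q * Q) ≤ 7 * (Q * θ) + 16 * (e * e)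
    cases {s} (t′ , et) (low p ep) sum θ≥ =
      subst (λ v → 21 * (Q * Q) ≤ 7 * (Q * θ) + 16 * (v * v)) (sym (e≡t′+p sum et ep)) (by-p (≤-total (2 * p) Q))
      where
      y : ℕ
      y = takagi (suc n) s
      open LowerHalf Q x y t t′ s p e θ
      θ≥′ : t + x + (s + y) + s ≤ θ + t
      θ≥′ = ≤-resp-≡ (cong (_+ s) (sym (cong₂ _+_ (takagi-low (suc n) t t′ et) (takagi-low (suc n) s p ep)))) refl θ≥
      by-p : (2 * p ≤ Q) ⊎ (Q ≤ 2 * p) → 21 * (Q * Q) ≤ 7 * (Q * θ) + 16 * ((t′ + p) * (t′ + p))
      by-p (inj₁ 2p≤Q) = small-p ep (19Q≤48t′ et 48t≤29Q) (takagi-parabola n t t′ et Q≤6t 48t≤29Q) θ≥′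
        (subst (p ≤_) (sym (takagi-sym (suc n) s p ep)) (k≤takagi (suc n) p (3p≤2Q 2p≤Q)))
      by-p (inj₂ Q≤2p) = large-p ep (19Q≤48t′ et 48t≤29Q) (takagi-parabola n t t′ et Q≤6t 48t≤29Q) θ≥′ Q≤2p
    cases (t′ , et) (high j j′ ej) sum θ≥ = reduce ej θ≥′ (by-j (≤-total (6 * j′) (5 * Q)) (≤-total (32 * t) (11 * Q)))
      where
      y : ℕ
      y = takagi (suc n) j
      open UpperHalf Q x y t t′ j j′ e θ
      θ≥′ : t + x + (j′ + y) + (Q + j) ≤ θ + t
      θ≥′ = ≤-resp-≡ (cong (_+ (Q + j)) (sym (cong₂ _+_ (takagi-low (suc n) t t′ et) (takagi-high (suc n) j j′ ej)))) refl θ≥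
      Q≤2x : Q ≤ 2 * x
      Q≤2x = ½≤takagi (suc n) t Q≤6t (6t≤5Q 48t≤29Q)
      by-j : (6 * j′ ≤ 5 * Q) ⊎ (5 * Q ≤ 6 * j′) → (32 * t ≤ 11 * Q) ⊎ (11 * Q ≤ 32 * t) →
             7 * (Q * Q) ≤ 7 * (Q * (x + y)) + 16 * (e * e)
      by-j (inj₁ 6j′≤5Q) _ = both-½ Q≤2x (½≤takagi (suc n) j (Q≤6j ej 6j′≤5Q) (6j≤5Q sum Q≤6t))
      by-j (inj₂ 5Q≤6j′) (inj₁ 32t≤11Q) = small-t (47Q≤96e ej sum 5Q≤6j′ 32t≤11Q) Q≤2x
      by-j (inj₂ 5Q≤6j′) (inj₂ 11Q≤32t) = large-t
        (subst (λ v → 32 * v ≤ 21 * Q) (t′≡e+j sum et) (32t′≤21Q et 11Q≤32t))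
        (3k≤takagi (suc n) j (6j≤Q ej 5Q≤6j′))
        (subst (λ v → 7 * (Q * Q) ≤ 7 * (Q * x) + 16 * (v * v)) (t′≡e+j sum et) (takagi-parabola n t t′ et Q≤6t 48t≤29Q))

-- Counting in the cube, and its edge-isoperimetric inequality.

module Hypercube where
  open Takagi
  open import Data.Fin using (Fin; zero; suc)
  open import Data.Vec using ([]; _∷_; lookup; insertAt)
  open import Data.Vec.Properties using (insertAt-lookup)
  open import Data.Nat
  open import Data.Nat.Properties
  open import Data.Nat.Tactic.RingSolver using (solve-∀)

  indicator : Bool → ℕ
  indicator false = 0
  indicator true  = 1

  count : ∀ {a} {A : Set a} → (A → Bool) → List A → ℕ
  count p xs = length (filterᵇ p xs)

  count-∷ : ∀ {a} {A : Set a} (p : A → Bool) x xs → count p (x ∷ xs) ≡ indicator (p x) + count p xs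
  count-∷ p x xs with p x
  ... | false = refl
  ... | true  = refl

  count-++ : ∀ {a} {A : Set a} (p : A → Bool) xs ys → count p (xs ++ ys) ≡ count p xs + count p ys
  count-++ p []       ys = refl
  count-++ p (x ∷ xs) ys = begin
    count p (x ∷ xs ++ ys)                          ≡⟨ count-∷ p x (xs ++ ys) ⟩
    indicator (p x) + count p (xs ++ ys)            ≡⟨ cong (indicator (p x) +_) (count-++ p xs ys) ⟩
    indicator (p x) + (count p xs + count p ys)     ≡⟨ +-assoc (indicator (p x)) _ _ ⟨
    indicator (p x) + count p xs + count p ys       ≡⟨ cong (_+ count p ys) (count-∷ p x xs) ⟨
    count p (x ∷ xs) + count p ys                   ∎
    where open ≡-Reasoning

  count-map : ∀ {a b} {A : Set a} {B : Set b} (p : B → Bool) (f : A → B) xs → count p (map f xs) ≡ count (p ∘ f) xs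
  count-map p f []       = refl
  count-map p f (x ∷ xs) =
    trans (count-∷ p (f x) (map f xs)) (trans (cong (indicator (p (f x)) +_) (count-map p f xs)) (sym (count-∷ (p ∘ f) x xs)))

  -- Recursion on the first coordinate, instead of a sum over the list of vertices, makes slicing
  -- along that coordinate hold by computation.
  ∑ᵛ : ∀ n → (Vertex n → ℕ) → ℕ
  ∑ᵛ zero    g = g []
  ∑ᵛ (suc n) g = ∑ᵛ n (g ∘ (false ∷_)) + ∑ᵛ n (g ∘ (true ∷_))

  ∑ᶠ : ∀ n → (Fin n → ℕ) → ℕ
  ∑ᶠ zero    g = 0
  ∑ᶠ (suc n) g = g zero + ∑ᶠ n (g ∘ suc)

  +-interchange : ∀ a b c d → a + b + (c + d) ≡ a + c + (b + d)
  +-interchange = solve-∀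

  ∑ᵛ-cong : ∀ n {g h} → (∀ x → g x ≡ h x) → ∑ᵛ n g ≡ ∑ᵛ n h
  ∑ᵛ-cong zero    g≗h = g≗h []
  ∑ᵛ-cong (suc n) g≗h = cong₂ _+_ (∑ᵛ-cong n (g≗h ∘ (false ∷_))) (∑ᵛ-cong n (g≗h ∘ (true ∷_)))

  ∑ᵛ-mono : ∀ n {g h} → (∀ x → g x ≤ h x) → ∑ᵛ n g ≤ ∑ᵛ n h
  ∑ᵛ-mono zero    g≤h = g≤h []
  ∑ᵛ-mono (suc n) g≤h = +-mono-≤ (∑ᵛ-mono n (g≤h ∘ (false ∷_))) (∑ᵛ-mono n (g≤h ∘ (true ∷_)))

  ∑ᵛ-+ : ∀ n g h → ∑ᵛ n (λ x → g x + h x) ≡ ∑ᵛ n g + ∑ᵛ n h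
  ∑ᵛ-+ zero    g h = refl
  ∑ᵛ-+ (suc n) g h = trans
    (cong₂ _+_ (∑ᵛ-+ n (g ∘ (false ∷_)) (h ∘ (false ∷_))) (∑ᵛ-+ n (g ∘ (true ∷_)) (h ∘ (true ∷_))))
    (+-interchange (∑ᵛ n (g ∘ (false ∷_))) (∑ᵛ n (h ∘ (false ∷_))) (∑ᵛ n (g ∘ (true ∷_))) (∑ᵛ n (h ∘ (true ∷_))))

  ∑ᵛ-0 : ∀ n → ∑ᵛ n (λ _ → 0) ≡ 0
  ∑ᵛ-0 zero    = refl
  ∑ᵛ-0 (suc n) = cong₂ _+_ (∑ᵛ-0 n) (∑ᵛ-0 n)

  ∑ᵛ-1 : ∀ n → ∑ᵛ n (λ _ → 1) ≡ 2 ^ n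
  ∑ᵛ-1 zero    = refl
  ∑ᵛ-1 (suc n) = cong₂ _+_ (∑ᵛ-1 n) (trans (∑ᵛ-1 n) (sym (+-identityʳ _)))

  ∑ᵛ-split : ∀ n (i : Fin (suc n)) g →
             ∑ᵛ (suc n) g ≡ ∑ᵛ n (λ x → g (insertAt x i false)) + ∑ᵛ n (λ x → g (insertAt x i true))
  ∑ᵛ-split n       zero    g = refl
  ∑ᵛ-split (suc n) (suc i) g = trans
    (cong₂ _+_ (∑ᵛ-split n i (g ∘ (false ∷_))) (∑ᵛ-split n i (g ∘ (true ∷_))))
    (+-interchange (∑ᵛ n (λ x → g (false ∷ insertAt x i false))) (∑ᵛ n (λ x → g (false ∷ insertAt x i true)))
                   (∑ᵛ n (λ x → g (true ∷ insertAt x i false))) (∑ᵛ n (λ x → g (true ∷ insertAt x i true))))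

  count-concatMap-allVertices : ∀ {a} {A : Set a} n (p : A → Bool) (g : Vertex n → List A) →
                                count p (concatMap g (allVertices n)) ≡ ∑ᵛ n (λ x → count p (g x))
  count-concatMap-allVertices zero p g = trans (count-++ p (g []) []) (+-identityʳ _)
  count-concatMap-allVertices (suc n) p g = begin
    count p (concatMap g (map (false ∷_) V ++ map (true ∷_) V))
      ≡⟨ cong (count p) (concatMap-++ g (map (false ∷_) V) (map (true ∷_) V)) ⟩
    count p (concatMap g (map (false ∷_) V) ++ concatMap g (map (true ∷_) V))
      ≡⟨ count-++ p (concatMap g (map (false ∷_) V)) _ ⟩
    count p (concatMap g (map (false ∷_) V)) + count p (concatMap g (map (true ∷_) V))
      ≡⟨ cong₂ (λ l r → count p l + count p r) (concatMap-map g (false ∷_) V) (concatMap-map g (true ∷_) V) ⟩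
    count p (concatMap (g ∘ (false ∷_)) V) + count p (concatMap (g ∘ (true ∷_)) V)
      ≡⟨ cong₂ _+_ (count-concatMap-allVertices n p (g ∘ (false ∷_))) (count-concatMap-allVertices n p (g ∘ (true ∷_))) ⟩
    ∑ᵛ (suc n) (λ x → count p (g x)) ∎
    where
    open ≡-Reasoning
    V : List (Vertex n)
    V = allVertices n

  count-allVertices : ∀ n (p : VSubset n) → count p (allVertices n) ≡ ∑ᵛ n (indicator ∘ p)
  count-allVertices zero    p = trans (count-∷ p [] []) (+-identityʳ _)
  count-allVertices (suc n) p = trans (count-++ p (map (false ∷_) (allVertices n)) _) (cong₂ _+_
    (trans (count-map p (false ∷_) (allVertices n)) (count-allVertices n (p ∘ (false ∷_))))
    (trans (count-map p (true ∷_) (allVertices n)) (count-allVertices n (p ∘ (true ∷_)))))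

  count-tabulate : ∀ {a} {A : Set a} n (p : A → Bool) (g : Fin n → A) → count p (tabulate g) ≡ ∑ᶠ n (indicator ∘ p ∘ g)
  count-tabulate zero    p g = refl
  count-tabulate (suc n) p g = trans (count-∷ p (g zero) _) (cong (indicator (p (g zero)) +_) (count-tabulate n p (g ∘ suc)))

  size : ∀ {n} → VSubset n → ℕ
  size {n} S = ∑ᵛ n (indicator ∘ S)

  distance : ∀ {n} → VSubset n → VSubset n → ℕ
  distance A B = size (λ x → A x xor B x)

  boundary : ∀ {n} → VSubset n → ℕ
  boundary {n} S = ∑ᵛ n (λ x → ∑ᶠ n (λ i → indicator (isCut S (x , i))))

  slice : ∀ {n} → VSubset (suc n) → Fin (suc n) → Bool → VSubset n
  slice S i a x = S (insertAt x i a)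

  card≡size : ∀ {n} (S : VSubset n) → card S ≡ size S
  card≡size {n} S = count-allVertices n S

  θ≡boundary : ∀ n (S : VSubset n) → θ n S ≡ boundary S
  θ≡boundary n S = trans (count-concatMap-allVertices n (isCut S) (λ x → map (x ,_) (allFin n))) (∑ᵛ-cong n λ x →
    trans (count-map (isCut S) (x ,_) (allFin n)) (count-tabulate n (λ i → isCut S (x , i)) (λ i → i)))

  size-slices : ∀ n (S : VSubset (suc n)) i → size S ≡ size (slice S i false) + size (slice S i true)
  size-slices n S i = ∑ᵛ-split n i (indicator ∘ S)

  halfPlaneCount≡size : ∀ {n} (S : VSubset (suc n)) i a → halfPlaneCount S i a ≡ size (slice S i a)
  halfPlaneCount≡size {n} S i a =
    trans (count-allVertices (suc n) (λ x → S x ∧ does (lookup x i ≟ᵇ a)))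
      (trans (∑ᵛ-split n i (λ x → indicator (S x ∧ does (lookup x i ≟ᵇ a)))) (pick a))
    where
    inPlane : ∀ a b x → indicator (S (insertAt x i b) ∧ does (lookup (insertAt x i b) i ≟ᵇ a))
                      ≡ indicator (S (insertAt x i b) ∧ does (b ≟ᵇ a))
    inPlane a b x = cong (λ c → indicator (S (insertAt x i b) ∧ does (c ≟ᵇ a))) (insertAt-lookup x i b)
    ∧-true : ∀ b → indicator (b ∧ true) ≡ indicator b
    ∧-true false = refl
    ∧-true true  = refl
    ∧-false : ∀ b → indicator (b ∧ false) ≡ 0
    ∧-false false = refl
    ∧-false true  = refl
    pick : ∀ a → ∑ᵛ n (λ x → indicator (S (insertAt x i false) ∧ does (lookup (insertAt x i false) i ≟ᵇ a)))
               + ∑ᵛ n (λ x → indicator (S (insertAt x i true) ∧ does (lookup (insertAt x i true) i ≟ᵇ a)))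
               ≡ size (slice S i a)
    pick false = trans (cong₂ _+_ (∑ᵛ-cong n λ x → trans (inPlane false false x) (∧-true _))
                                  (trans (∑ᵛ-cong n λ x → trans (inPlane false true x) (∧-false _)) (∑ᵛ-0 n))) (+-identityʳ _)
    pick true  = cong₂ _+_ (trans (∑ᵛ-cong n λ x → trans (inPlane true false x) (∧-false _)) (∑ᵛ-0 n))
                           (∑ᵛ-cong n λ x → trans (inPlane true true x) (∧-true _))

  -- Each edge in direction `zero` is counted at its endpoint with first bit `false`, and these
  -- edges sum to the distance of the slices. All other edges stay inside one slice.
  boundary-∷ : ∀ n (S : VSubset (suc n)) →
    boundary S ≡ boundary (slice S zero false) + boundary (slice S zero true) + distance (slice S zero false) (slice S zero true)
  boundary-∷ n S = trans (cong (_+ boundary (slice S zero true)) (∑ᵛ-+ n _ _))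
    (rotate (distance (slice S zero false) (slice S zero true)) (boundary (slice S zero false)) (boundary (slice S zero true)))
    where
    rotate : ∀ d b₀ b₁ → d + b₀ + b₁ ≡ b₀ + b₁ + d
    rotate = solve-∀

  -- Cutting along both the first coordinate and `i` gives four quarters. Their boundaries and the
  -- four distances between adjacent quarters can be grouped by either coordinate first.
  boundary-slices : ∀ n (S : VSubset (suc n)) i →
    boundary S ≡ boundary (slice S i false) + boundary (slice S i true) + distance (slice S i false) (slice S i true)
  boundary-slices n S zero = boundary-∷ n S
  boundary-slices (suc n) S (suc i) = begin
    boundary S
      ≡⟨ boundary-∷ (suc n) S ⟩
    boundary A + boundary B + distance A B
      ≡⟨ cong₂ _+_ (cong₂ _+_ (boundary-slices n A i) (boundary-slices n B i)) (size-slices n (λ x → A x xor B x) i) ⟩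
    boundary A₀ + boundary A₁ + distance A₀ A₁ + (boundary B₀ + boundary B₁ + distance B₀ B₁) + (distance A₀ B₀ + distance A₁ B₁)
      ≡⟨ regroup (boundary A₀) (boundary A₁) (distance A₀ A₁) (boundary B₀) (boundary B₁) (distance B₀ B₁) (distance A₀ B₀) (distance A₁ B₁) ⟩
    boundary A₀ + boundary B₀ + distance A₀ B₀ + (boundary A₁ + boundary B₁ + distance A₁ B₁) + (distance A₀ A₁ + distance B₀ B₁)
      ≡⟨ cong (_+ (distance A₀ A₁ + distance B₀ B₁))
           (cong₂ _+_ (boundary-∷ n (slice S (suc i) false)) (boundary-∷ n (slice S (suc i) true))) ⟨
    boundary (slice S (suc i) false) + boundary (slice S (suc i) true) + distance (slice S (suc i) false) (slice S (suc i) true) ∎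
    where
    open ≡-Reasoning
    A B : VSubset (suc n)
    A = slice S zero false
    B = slice S zero true
    A₀ A₁ B₀ B₁ : VSubset n
    A₀ = slice A i false
    A₁ = slice A i true
    B₀ = slice B i false
    B₁ = slice B i true
    regroup : ∀ a₀ a₁ a b₀ b₁ b c₀ c₁ → a₀ + a₁ + a + (b₀ + b₁ + b) + (c₀ + c₁) ≡ a₀ + b₀ + c₀ + (a₁ + b₁ + c₁) + (a + b)
    regroup = solve-∀

  size≤2^n : ∀ n (S : VSubset n) → size S ≤ 2 ^ n
  size≤2^n n S = subst (size S ≤_) (∑ᵛ-1 n) (∑ᵛ-mono n (λ x → indicator≤1 (S x)))
    where
    indicator≤1 : ∀ b → indicator b ≤ 1
    indicator≤1 false = z≤n
    indicator≤1 true  = ≤-refl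

  distance-comm : ∀ n (A B : VSubset n) → distance A B ≡ distance B A
  distance-comm n A B = ∑ᵛ-cong n λ x → cong indicator (xor-comm (A x) (B x))

  size≤size+distance : ∀ n (A B : VSubset n) → size B ≤ size A + distance A B
  size≤size+distance n A B = subst (size B ≤_) (∑ᵛ-+ n _ _) (∑ᵛ-mono n λ x → pointwise (A x) (B x))
    where
    pointwise : ∀ a b → indicator b ≤ indicator a + indicator (a xor b)
    pointwise false b     = ≤-refl
    pointwise true  false = z≤n
    pointwise true  true  = ≤-refl

  -- The halves contribute their own boundaries by induction; the size difference in the midpoint
  -- inequality is paid for by the edges between them.
  takagi≤boundary : ∀ n (S : VSubset n) → takagi n (size S) ≤ boundary S
  takagi≤boundary zero    S = z≤n
  takagi≤boundary (suc n) S = subst (takagi (suc n) (size S) ≤_) (sym (boundary-∷ n S)) (ordered (≤-total (size A) (size B)))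
    where
    A B : VSubset n
    A = slice S zero false
    B = slice S zero true
    combine : ∀ {x a b α β d tα tβ} → x + a ≤ tα + tβ + b → tα ≤ α → tβ ≤ β → b ≤ a + d → x ≤ α + β + d
    combine {x} {a} {b} {α} {β} {d} {tα} {tβ} h hα hβ hd = ≤-by-certificate 1 x (α + β + d) 0
      (+-mono-≤ (+-mono-≤ (+-mono-≤ h hα) hβ) hd) (identity x a b α β d tα tβ)
      where
      identity : ∀ x a b α β d tα tβ → 1 * x + (tα + tβ + b + α + β + (a + d)) + 0 ≡ 1 * (α + β + d) + (x + a + tα + tβ + b)
      identity = solve-∀
    ordered : (size A ≤ size B) ⊎ (size B ≤ size A) → takagi (suc n) (size A + size B) ≤ boundary A + boundary B + distance A B
    ordered (inj₁ A≤B) = combine (takagi-midconvex n (size A) (size B) A≤B (size≤2^n n B))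
      (takagi≤boundary n A) (takagi≤boundary n B) (size≤size+distance n A B)
    ordered (inj₂ B≤A) = ≤-resp-≡ (cong (takagi (suc n)) (+-comm (size A) (size B)))
      (cong₂ _+_ (+-comm (boundary A) (boundary B)) (distance-comm n A B))
      (combine (takagi-midconvex n (size B) (size A) B≤A (size≤2^n n A))
        (takagi≤boundary n B) (takagi≤boundary n A) (size≤size+distance n B A))

  split-bound : ∀ n (S : VSubset (suc n)) i a s → size S ≡ s + size (slice S i a) →
    takagi n (size (slice S i a)) + takagi n s + s ≤ boundary S + size (slice S i a)
  split-bound n S i a s eq = subst (λ b → takagi n (size (slice S i a)) + takagi n s + s ≤ b + size (slice S i a))
    (sym (boundary-slices n S i)) (bound a eq)
    where
    A B : VSubset n
    A = slice S i false
    B = slice S i true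
    combine : ∀ {a b α β d tα tβ} → tα ≤ α → tβ ≤ β → b ≤ a + d → tα + tβ + b ≤ α + β + d + a
    combine {a} {b} {α} {β} {d} {tα} {tβ} hα hβ hd = ≤-by-certificate 1 (tα + tβ + b) (α + β + d + a) 0
      (+-mono-≤ (+-mono-≤ hα hβ) hd) (identity a b α β d tα tβ)
      where
      identity : ∀ a b α β d tα tβ → 1 * (tα + tβ + b) + (α + β + (a + d)) + 0 ≡ 1 * (α + β + d + a) + (tα + tβ + b)
      identity = solve-∀
    bound : ∀ a → size S ≡ s + size (slice S i a) →
            takagi n (size (slice S i a)) + takagi n s + s ≤ boundary A + boundary B + distance A B + size (slice S i a)
    bound false eq with refl ← +-cancelʳ-≡ (size A) s (size B) (trans (sym eq) (trans (size-slices n S i) (+-comm (size A) (size B)))) =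
      combine (takagi≤boundary n A) (takagi≤boundary n B) (size≤size+distance n A B)
    bound true eq with refl ← +-cancelʳ-≡ (size B) s (size A) (trans (sym eq) (size-slices n S i)) =
      ≤-resp-≡ refl (cong (_+ size B) (cong₂ _+_ (+-comm (boundary A) (boundary B)) (distance-comm n A B)))
        (combine (takagi≤boundary n B) (takagi≤boundary n A) (size≤size+distance n B A))

  -- A fold of `⊓` returns its seed or an element of the list. The seed stays possible here and is
  -- excluded later by the upper bound on t.
  Type-attained : ∀ n (S : VSubset n) → (Type S ≡ 2 ^ n) ⊎ ∃₂ λ i a → halfPlaneCount S i a ≡ Type S
  Type-attained n S = cases (foldr-selective ⊓-sel (2 ^ n) (concatMap counts (allFin n)))
    where
    counts : Fin n → List ℕ
    counts i = halfPlaneCount S i false ∷ halfPlaneCount S i true ∷ []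
    cases : (Type S ≡ 2 ^ n) ⊎ Type S ∈ concatMap counts (allFin n) → (Type S ≡ 2 ^ n) ⊎ ∃₂ λ i a → halfPlaneCount S i a ≡ Type S
    cases (inj₁ seed) = inj₁ seed
    cases (inj₂ t∈) with find (∈-concatMap⁻ counts {xs = allFin n} t∈)
    ... | i , _ , here eq         = inj₂ (i , false , sym eq)
    ... | i , _ , there (here eq) = inj₂ (i , true , sym eq)

-- The theorem with denominators cleared.

module IntegerForm where
  open Takagi
  open Hypercube
  open import Data.Nat
  open import Data.Nat.Properties
  open import Data.Nat.Tactic.RingSolver using (solve)

  -- The theorem multiplied by 28 · 2ⁿ, with d = 2ⁿ - 2k.
  θ-bound : ∀ n k t → 3 ≤ n → 0 < 2 * t → 2 * t ≤ k → k ≤ 2 ^ (n ∸ 1) → 2 ^ n ≤ 24 * t → 192 * t ≤ 29 * 2 ^ n →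
            (S : VSubset n) → card S ≡ k → Type S ≡ t →
            ∃ λ d → 2 * k + d ≡ 2 ^ n × 21 * (2 ^ n * 2 ^ n) ≤ 28 * (2 ^ n * θ n S) + 64 * (d * d)
  θ-bound zero k t ()
  θ-bound (suc zero) k t (s≤s ())
  θ-bound (suc (suc zero)) k t (s≤s (s≤s ()))
  -- n ≥ 3 leaves room for three descents: to the halves in dimension l + 2, to the unit Q = 2ˡ⁺¹,
  -- and once more inside the parabola bound.
  θ-bound (suc (suc (suc l))) k t _ 0<2t 2t≤k k≤ ≤24t 192t≤ S |S|≡k Type≡t =
    cases (Type-attained n S) (complement k≤) (complement (≤-trans (m≤m+n t (t + 0)) 2t≤k))
    where
    n : ℕ
    n = suc (suc (suc l))
    2t≤0 : ∀ N → t ≡ N → 192 * t ≤ 29 * N → 2 * t ≤ 0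
    2t≤0 N refl le = ≤-by-certificate 1 (2 * t) 0 (161 * t) le (solve (t ∷ []))
    Q≤6t : ∀ Q → 2 * (2 * Q) ≤ 24 * t → Q ≤ 6 * t
    Q≤6t Q le = ≤-by-certificate 4 Q (6 * t) 0 le (solve (Q ∷ t ∷ []))
    48t≤29Q : ∀ Q → 192 * t ≤ 29 * (2 * (2 * Q)) → 48 * t ≤ 29 * Q
    48t≤29Q Q le = ≤-by-certificate 4 (48 * t) (29 * Q) 0 le (solve (Q ∷ t ∷ []))
    rescale : ∀ Q e θ → 21 * (Q * Q) ≤ 7 * (Q * θ) + 16 * (e * e) →
              21 * (2 * (2 * Q) * (2 * (2 * Q))) ≤ 28 * (2 * (2 * Q) * θ) + 64 * (2 * e * (2 * e))
    rescale Q e θ le = ≤-by-certificate 1 (21 * (2 * (2 * Q) * (2 * (2 * Q)))) (28 * (2 * (2 * Q) * θ) + 64 * (2 * e * (2 * e))) 0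
      (scale 16 le) (solve (Q ∷ θ ∷ e ∷ []))
    cases : (Type S ≡ 2 ^ n) ⊎ (∃₂ λ i a → halfPlaneCount S i a ≡ Type S) → (∃ λ e → k + e ≡ 2 ^ suc (suc l)) → (∃ λ s → t + s ≡ k) →
            ∃ λ d → 2 * k + d ≡ 2 ^ n × 21 * (2 ^ n * 2 ^ n) ≤ 28 * (2 ^ n * θ n S) + 64 * (d * d)
    -- t = 2ⁿ is compatible with 192 t ≤ 29 · 2ⁿ only if t = 0, against 0 < 2t.
    cases (inj₁ Type≡2ⁿ) _ _ = ⊥-elim (<⇒≱ 0<2t (2t≤0 (2 ^ n) (trans (sym Type≡t) Type≡2ⁿ) 192t≤))
    cases (inj₂ (i , a , attained)) (e , k+e) (s , t+s) =
      2 * e , trans (sym (*-distribˡ-+ 2 k e)) (cong (2 *_) k+e) , rescale (2 ^ suc l) e (θ n S)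
        (split-inequality l t s e (θ n S) (trans (cong (_+ e) s+t) k+e) (Q≤6t (2 ^ suc l) ≤24t) (48t≤29Q (2 ^ suc l) 192t≤)
          (subst₂ (λ u b → takagi (suc (suc l)) u + takagi (suc (suc l)) s + s ≤ b + u) slice≡t (sym (θ≡boundary n S))
            (split-bound (suc (suc l)) S i a s |S|≡s+slice)))
      where
      slice≡t : size (slice S i a) ≡ t
      slice≡t = trans (sym (halfPlaneCount≡size S i a)) (trans attained Type≡t)
      s+t : s + t ≡ k
      s+t = trans (+-comm s t) t+s
      |S|≡s+slice : size S ≡ s + size (slice S i a)
      |S|≡s+slice = trans (sym (card≡size S)) (trans |S|≡k (trans (sym s+t) (cong (s +_) (sym slice≡t))))

-- Transfer to rational numbers.

module Rationals where
  open import Data.Nat hiding (_/_)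
  open import Data.Nat.Properties using (*-monoʳ-≤)
  open import Data.Nat.Tactic.RingSolver using (solve-∀)
  open import Data.Integer using (ℤ; +_; +≤+)
  import Data.Integer as ℤ
  import Data.Integer.Properties as ℤ
  import Data.Integer.Tactic.RingSolver as ℤSolver
  open import Data.Rational using (ℚ; _/_; toℚᵘ)
  import Data.Rational as ℚ
  import Data.Rational.Properties as ℚ
  open import Data.Rational.Unnormalised using (ℚᵘ; mkℚᵘ; *≤*)
  import Data.Rational.Unnormalised as ℚᵘ
  import Data.Rational.Unnormalised.Properties as ℚᵘ

  /-cross-≤ : ∀ a b c d .{{_ : NonZero b}} .{{_ : NonZero d}} → (+ a / b) ℚ.≤ (+ c / d) → a * d ≤ c * b
  /-cross-≤ a (suc b) c (suc d) le with ℚᵘ.≤-respˡ-≃ (ℚ.toℚᵘ-fromℚᵘ (mkℚᵘ (+ a) b)) (ℚᵘ.≤-respʳ-≃ (ℚ.toℚᵘ-fromℚᵘ (mkℚᵘ (+ c) d)) (ℚ.toℚᵘ-mono-≤ le))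
  ... | *≤* ad≤cb = ℤ.drop‿+≤+ (subst₂ ℤ._≤_ (sym (ℤ.pos-* a (suc d))) (sym (ℤ.pos-* c (suc b))) ad≤cb)

  -- A copy of `f` without reduction to lowest terms, so that numerators and denominators are
  -- explicit polynomials. `mkℚᵘ` takes the denominator minus one.
  fᵘ : ℚᵘ → ℚᵘ
  fᵘ x = mkℚᵘ (+ 3) 3 ℚᵘ.- mkℚᵘ (+ 64) 6 ℚᵘ.* ((x ℚᵘ.- mkℚᵘ (+ 1) 1) ℚᵘ.* (x ℚᵘ.- mkℚᵘ (+ 1) 1))

  toℚᵘ-homo-f : ∀ x → toℚᵘ (f x) ℚᵘ.≃ fᵘ (toℚᵘ x)
  toℚᵘ-homo-f x = ℚᵘ.≃-trans (ℚ.toℚᵘ-homo-+ (+ 3 / 4) (ℚ.- (+ 64 / 7 ℚ.* (y ℚ.* y)))) (ℚᵘ.+-congʳ (mkℚᵘ (+ 3) 3)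
    (ℚᵘ.≃-trans (ℚ.toℚᵘ-homo‿- (+ 64 / 7 ℚ.* (y ℚ.* y))) (ℚᵘ.-‿cong
      (ℚᵘ.≃-trans (ℚ.toℚᵘ-homo-* (+ 64 / 7) (y ℚ.* y)) (ℚᵘ.*-congˡ {mkℚᵘ (+ 64) 6}
        (ℚᵘ.≃-trans (ℚ.toℚᵘ-homo-* y y) (ℚᵘ.*-cong y≃ y≃)))))))
    where
    y : ℚ
    y = x ℚ.- + 1 / 2
    y≃ : toℚᵘ y ℚᵘ.≃ toℚᵘ x ℚᵘ.- mkℚᵘ (+ 1) 1
    y≃ = ℚ.toℚᵘ-homo-+ x (ℚ.- (+ 1 / 2))

  fᵘ-cong : ∀ {x y} → x ℚᵘ.≃ y → fᵘ x ℚᵘ.≃ fᵘ y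
  fᵘ-cong {x} {y} x≃y = ℚᵘ.+-congʳ (mkℚᵘ (+ 3) 3) (ℚᵘ.-‿cong (ℚᵘ.*-congˡ {mkℚᵘ (+ 64) 6} (ℚᵘ.*-cong shift shift)))
    where
    shift : x ℚᵘ.- mkℚᵘ (+ 1) 1 ℚᵘ.≃ y ℚᵘ.- mkℚᵘ (+ 1) 1
    shift = ℚᵘ.+-congˡ (ℚᵘ.- mkℚᵘ (+ 1) 1) x≃y

  -- Over the denominator 112 N², with d = N - 2k, the left side is N (84 N² - 256 d²).
  scaled-f≤ᵘ : ∀ N-1 k d m → let N = suc N-1 in 2 * k + d ≡ N → 21 * (N * N) ≤ 28 * (N * m) + 64 * (d * d) →
              mkℚᵘ (+ N) 0 ℚᵘ.* fᵘ (mkℚᵘ (+ k) N-1) ℚᵘ.≤ mkℚᵘ (+ m) 0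
  scaled-f≤ᵘ N-1 k d m eq le = *≤* goal
    where
    N D : ℕ
    N = suc N-1
    -- `D` is the unreduced denominator of (64/7)(k/N - 1/2)², and `u` = 2k - N = -d is the
    -- numerator of k/N - 1/2 over 2N.
    D = 7 * (N * 2 * (N * 2))
    u : ℤ
    u = + k ℤ.* + 2 ℤ.+ ℤ.- + 1 ℤ.* + N
    +D≡ : + D ≡ + 7 ℤ.* (+ N ℤ.* + 2 ℤ.* (+ N ℤ.* + 2))
    +D≡ = trans (ℤ.pos-* 7 (N * 2 * (N * 2))) (cong (+ 7 ℤ.*_)
      (trans (ℤ.pos-* (N * 2) (N * 2)) (cong₂ ℤ._*_ (ℤ.pos-* N 2) (ℤ.pos-* N 2))))
    +N≡ : + N ≡ + 2 ℤ.* + k ℤ.+ + d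
    +N≡ = trans (cong +_ (sym eq)) (trans (ℤ.pos-+ (2 * k) d) (cong (ℤ._+ + d) (ℤ.pos-* 2 k)))
    u≡ : u ≡ ℤ.- + d
    u≡ = trans (cong (λ v → + k ℤ.* + 2 ℤ.+ ℤ.- + 1 ℤ.* v) +N≡) (cancel (+ k) (+ d))
      where
      cancel : ∀ κ δ → κ ℤ.* + 2 ℤ.+ ℤ.- + 1 ℤ.* (+ 2 ℤ.* κ ℤ.+ δ) ≡ ℤ.- δ
      cancel = ℤSolver.solve-∀
    cube : 84 * (N * N * N) ≤ 112 * (N * N * m) + 256 * (N * (d * d))
    cube = subst₂ _≤_ (left N) (right N m d) (*-monoʳ-≤ (4 * N) le)
      where
      left : ∀ N → 4 * N * (21 * (N * N)) ≡ 84 * (N * N * N)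
      left = solve-∀
      right : ∀ N m d → 4 * N * (28 * (N * m) + 64 * (d * d)) ≡ 112 * (N * N * m) + 256 * (N * (d * d))
      right = solve-∀
    lhs≡ : (+ N ℤ.* (+ 3 ℤ.* + D ℤ.+ ℤ.- (+ 64 ℤ.* (u ℤ.* u)) ℤ.* + 4)) ℤ.* + 1
         ≡ + (84 * (N * N * N)) ℤ.- + (256 * (N * (d * d)))
    lhs≡ = trans (cong₂ (λ v w → (+ N ℤ.* (+ 3 ℤ.* v ℤ.+ ℤ.- (+ 64 ℤ.* (w ℤ.* w)) ℤ.* + 4)) ℤ.* + 1) +D≡ u≡)
      (trans (expand (+ N) (+ d)) (sym (cong₂ ℤ._-_
        (trans (ℤ.pos-* 84 (N * N * N)) (cong (+ 84 ℤ.*_) (trans (ℤ.pos-* (N * N) N) (cong (ℤ._* + N) (ℤ.pos-* N N)))))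
        (trans (ℤ.pos-* 256 (N * (d * d))) (cong (+ 256 ℤ.*_) (trans (ℤ.pos-* N (d * d)) (cong (+ N ℤ.*_) (ℤ.pos-* d d))))))))
      where
      expand : ∀ ν δ → (ν ℤ.* (+ 3 ℤ.* (+ 7 ℤ.* (ν ℤ.* + 2 ℤ.* (ν ℤ.* + 2))) ℤ.+ ℤ.- (+ 64 ℤ.* (ℤ.- δ ℤ.* ℤ.- δ)) ℤ.* + 4)) ℤ.* + 1
             ≡ + 84 ℤ.* (ν ℤ.* ν ℤ.* ν) ℤ.- + 256 ℤ.* (ν ℤ.* (δ ℤ.* δ))
      expand = ℤSolver.solve-∀
    rhs≡ : + m ℤ.* + (1 * (4 * D)) ≡ + (112 * (N * N * m))
    rhs≡ = trans (sym (ℤ.pos-* m (1 * (4 * D)))) (cong +_ (regroup N m))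
      where
      regroup : ∀ N m → m * (1 * (4 * (7 * (N * 2 * (N * 2))))) ≡ 112 * (N * N * m)
      regroup = solve-∀
    move : ∀ a b c → a ≤ b + c → + a ℤ.- + c ℤ.≤ + b
    move a b c a≤b+c = subst (+ a ℤ.- + c ℤ.≤_)
      (trans (cong (ℤ._- + c) (ℤ.pos-+ b c)) (cancel (+ b) (+ c))) (ℤ.+-monoˡ-≤ (ℤ.- + c) (+≤+ a≤b+c))
      where
      cancel : ∀ β γ → β ℤ.+ γ ℤ.- γ ≡ β
      cancel = ℤSolver.solve-∀
    goal : (+ N ℤ.* (+ 3 ℤ.* + D ℤ.+ ℤ.- (+ 64 ℤ.* (u ℤ.* u)) ℤ.* + 4)) ℤ.* + 1 ℤ.≤ + m ℤ.* + (1 * (4 * D))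
    goal = subst₂ ℤ._≤_ (sym lhs≡) (sym rhs≡) (move (84 * (N * N * N)) (112 * (N * N * m)) (256 * (N * (d * d))) cube)

  scaled-f≤ : ∀ N .{{_ : NonZero N}} k d m → 2 * k + d ≡ N → 21 * (N * N) ≤ 28 * (N * m) + 64 * (d * d) →
              (+ N / 1) ℚ.* f (+ k / N) ℚ.≤ + m / 1
  scaled-f≤ (suc N-1) k d m eq le = ℚ.toℚᵘ-cancel-≤
    (ℚᵘ.≤-respˡ-≃ (ℚᵘ.≃-sym lhs≃) (ℚᵘ.≤-respʳ-≃ (ℚᵘ.≃-sym (ℚ.toℚᵘ-fromℚᵘ (mkℚᵘ (+ m) 0))) (scaled-f≤ᵘ N-1 k d m eq le)))
    where
    N : ℕ
    N = suc N-1
    lhs≃ : toℚᵘ ((+ N / 1) ℚ.* f (+ k / N)) ℚᵘ.≃ mkℚᵘ (+ N) 0 ℚᵘ.* fᵘ (mkℚᵘ (+ k) N-1)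
    lhs≃ = ℚᵘ.≃-trans (ℚ.toℚᵘ-homo-* (+ N / 1) (f (+ k / N))) (ℚᵘ.*-cong (ℚ.toℚᵘ-fromℚᵘ (mkℚᵘ (+ N) 0))
      (ℚᵘ.≃-trans (toℚᵘ-homo-f (+ k / N)) (fᵘ-cong (ℚ.toℚᵘ-fromℚᵘ (mkℚᵘ (+ k) N-1)))))

open IntegerForm using (θ-bound)
open Rationals using (/-cross-≤; scaled-f≤)
open import Data.Nat using (ℕ; _≤_; _<_; _*_; _^_; _∸_)
open import Data.Nat.Properties using (m^n≢0; *-comm; *-identityˡ)
open import Data.Integer using (+_)
open import Data.Rational using (ℚ; _/_; _+_)
open import Data.Rational using () renaming (_≤_ to _≤ℚ_; _*_ to _*ℚ_)

theorem1p2 : (n k t : ℕ) → 3 ≤ n → 0 < 2 * t → 2 * t ≤ k → k ≤ 2 ^ (n ∸ 1) →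
    (+ 1 / 24) ≤ℚ (t /2^ n) → (t /2^ n) ≤ℚ ((+ 1 / 24) + (+ 7 / 64)) →
    (S : VSubset n) → card S ≡ k → Type S ≡ t →
    ((+ (2 ^ n)) / 1) *ℚ f (k /2^ n) ≤ℚ ((+ θ n S) / 1)
theorem1p2 n k t 3≤n 0<2t 2t≤k k≤ 1/24≤ ≤29/192 S |S|≡k Type≡t =
  let instance _ = m^n≢0 2 n
      2ⁿ≤24t = subst₂ _≤_ (*-identityˡ (2 ^ n)) (*-comm t 24) (/-cross-≤ 1 24 t (2 ^ n) 1/24≤)
      -- The closed sum 1/24 + 7/64 computes to 29/192.
      192t≤ = subst (_≤ 29 * 2 ^ n) (*-comm t 192) (/-cross-≤ t (2 ^ n) 29 192 ≤29/192)
      d , 2k+d , bound = θ-bound n k t 3≤n 0<2t 2t≤k k≤ 2ⁿ≤24t 192t≤ S |S|≡k Type≡t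
  in scaled-f≤ (2 ^ n) k d (θ n S) 2k+d bound
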